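{- A computon $\lambda$ is a connected computon if and only if a head-iterative computon $*_\rho(\lambda)$ exists for some h-diagram $\rho$ (in which $\lambda$ is the computon being iterated over).
   Context: $\mathbf{Set}$ is the category of finite sets and total functions. A computon $\lambda$ is a tuple $(U,P,I,O,\Sigma,\sigma,\tau,t,s,c)$ (a functor into $\mathbf{Set}$ from the free category on the arrows $\sigma:O\to U$, $\tau:I\to U$, $t:O\to P$, $s:I\to P$, $c:P\to\Sigma$) where $U$ (computation units), $I$ and $O$ (edges) are possibly empty finite sets, $P$ (ports) is a non-empty finite set, $\Sigma\subset\mathbb{N}$ (colours) is finite with $0\in\Sigma$, the functions $\sigma,\tau,c$ are surjective, and: the restrictions $\sigma|_{(c\circ t)^{ -1}(0)}$ and $\tau|_{(c\circ s)^{ -1}(0)}$ are surjective onto $U$; there is $p\in P\setminus \mathrm{Im}(s)$ with $c(p)=0$; there is $q\in P\setminus \mathrm{Im}(t)$ with $c(q)=0$. Components of $\lambda_j$ carry the subscript $j$. Put $P^+=P\setminus \mathrm{Im}(t)$ (e-inports) and $P^-=P\setminus \mathrm{Im}(s)$ (e-outports). Write $p\xrightarrow{i}u$ if $s(i)=p,\ \tau(i)=u$, and $u\xrightarrow{o}p$ if $\sigma(o)=u,\ t(o)=p$. For a port $p$, $\bullet p=\{u\in U\mid \exists o\in O,\ u\xrightarrow{o}p\}$ and $p\bullet=\{u\in U\mid\exists i\in I,\ p\xrightarrow{i}u\}$. Write $p_1\xrightarrow{\exists}p_n$ if there is a chain $p_1\xrightarrow{i_1}u_1\xrightarrow{o_1}p_2\cdots\xrightarrow{i_{n-1}}u_{n-1}\xrightarrow{o_{n-1}}p_n$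 with $n\ge 2$. A computon is connected if for each $p\in \mathrm{Im}(s)\cup P^+$ there is $q\in P^-$ with $p\xrightarrow{\exists}q$. A computon morphism $\alpha:\lambda_1\to\lambda_2$ is a natural transformation (functions $\alpha_U,\alpha_P,\alpha_I,\alpha_O,\alpha_\Sigma$ commuting with $\sigma,\tau,t,s,c$) such that $\alpha_\Sigma$ is the inclusion $\Sigma_1\subseteq\Sigma_2$ and $\vec{i}(\alpha)\cup\vec{o}(\alpha)\subseteq P_1^+\cup P_1^-$, where $\vec{i}(\alpha)=\{p\in P_1\mid \bullet\alpha(p)\setminus\alpha(\bullet p)\ne\emptyset\}$ and $\vec{o}(\alpha)=\{p\in P_1\mid \alpha(p)\bullet\setminus\alpha(p\bullet)\neq\emptyset\}$. Here $\alpha(p)=\alpha_P(p)$ and $\alpha(A)$ is the image of a set $A$ of ports or units. Computons and computon morphisms form the category $\mathbf{Set}^{\mathbf{Comp}}$ (componentwise composition). In this category, colimits (when they exist) are computed componentwise in $\mathbf{Set}$ on $U,P,I,O$, with the $\Sigma$-component being the union of the colour sets and with the induced structure functions. A trivial computon is one with $U=I=O=\emptyset$. An in-marker of a computon $\lambda$ is a computon monomorphism $\lambda^+:\lambda_0\to\lambda$ with $\lambda_0$ a trivial computon and $\lambda^+(P_0)=P^+$; an out-marker of $\lambda$ is a computon monomorphism $\lambda^-:\lambda_0\to\lambda$ with $\lambda_0$ trivial and $\lambda^-(P_0)=P^-$. An h-diagram $\rho$ is a diagram in $\mathbf{Set}^{\mathbf{Comp}}$ consisting of trivial computons $\lambda_0,\lambda_1$,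 connected computons $\lambda,\lambda_2,\lambda_3,\lambda_4$, and the markers $\lambda_2^-:\lambda_0\to\lambda_2$, $\lambda_4^+:\lambda_0\to\lambda_4$, $\lambda^+:\lambda_0\to\lambda$, $\lambda_3^-:\lambda_0\to\lambda_3$, $\lambda^-:\lambda_1\to\lambda$, $\lambda_3^+:\lambda_1\to\lambda_3$ (superscript $+$ denotes an in-marker, $-$ an out-marker, of the computon named). A head-iterative computon is the colimit of an h-diagram; the colimit of this $\rho$ is denoted $*_\rho(\lambda)$.
   Formalization: "Colimit" means the componentwise colimit with computon-morphism legs; mediating maps are natural transformations with colour inclusion, not necessarily computon morphisms, since with that boundary condition no h-diagram has a colimit. -}

module Defs where

open import Data.Bool using (Bool; true)
open import Data.Fin using (Fin)
open import Data.Fin.Properties using (2↔Bool)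
open import Data.List using (List)
open import Data.List.Membership.Propositional using () renaming (_∈_ to _∈ₗ_)
open import Data.List.Relation.Binary.Subset.Propositional using () renaming (_⊆_ to _⊆ₗ_)
open import Data.Nat using (ℕ)
open import Data.Nat.Properties using (_≟_)
open import Data.Product using (∃-syntax; Σ-syntax; _×_; _,_; proj₁; proj₂)
open import Function using (_∘_; _↔_; _⇔_; Equivalence)
open import Function.Definitions using (StrictlySurjective)
open import Function.Properties.Inverse using (↔-sym)
open import Level using (0ℓ)
open import Relation.Binary.Construct.Closure.Transitive using (TransClosure)
open import Relation.Binary.PropositionalEquality
  using (_≡_; refl; sym; trans; cong; module ≡-Reasoning)
open import Relation.Nullary using (¬_; Dec; yes; does)
open import Relation.Nullary.Decidable using (dec-true)
open import Relation.Unary using (Pred; _∈_; _∉_; _⊆_; _≐_; _∪_; _∖_; ∁; Satisfiable)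

record FinSet : Set₁ where
  field
    Carrier : Set
    size    : ℕ
    enum    : Carrier ↔ Fin size

open FinSet public using () renaming (Carrier to ∣_∣)

Im : {A B : Set} → (A → B) → Pred B 0ℓ
Im f y = ∃[ x ] f x ≡ y

Image : {A B : Set} → (A → B) → Pred A 0ℓ → Pred B 0ℓ
Image f A y = ∃[ x ] (x ∈ A × f x ≡ y)

-- The finite set of colours is a list of naturals that is only ever used
-- through membership, so order and repetitions are irrelevant.  The
-- function c : P → Σ is given by its underlying function to ℕ.

record Computon : Set₁ where
  field
    U P I O : FinSet
    colours : List ℕ
    σ : ∣ O ∣ → ∣ U ∣
    τ : ∣ I ∣ → ∣ U ∣
    t : ∣ O ∣ → ∣ P ∣
    s : ∣ I ∣ → ∣ P ∣
    c : ∣ P ∣ → ℕ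

    P-nonempty : ∣ P ∣
    c-into     : ∀ p → c p ∈ₗ colours
    0-colour   : 0 ∈ₗ colours

    σ-surj : StrictlySurjective _≡_ σ
    τ-surj : StrictlySurjective _≡_ τ
    c-surj : ∀ {k} → k ∈ₗ colours → ∃[ p ] c p ≡ k

    σ-surj₀ : ∀ u → ∃[ o ] (c (t o) ≡ 0 × σ o ≡ u)
    τ-surj₀ : ∀ u → ∃[ i ] (c (s i) ≡ 0 × τ i ≡ u)

    outport₀ : ∃[ p ] (p ∉ Im s × c p ≡ 0)
    inport₀  : ∃[ q ] (q ∉ Im t × c q ≡ 0)

  P⁺ P⁻ : Pred ∣ P ∣ 0ℓ
  P⁺ = ∁ (Im t)
  P⁻ = ∁ (Im s)

  _—[_]→ᵢ_ : ∣ P ∣ → ∣ I ∣ → ∣ U ∣ → Set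
  p —[ i ]→ᵢ u = s i ≡ p × τ i ≡ u

  _—[_]→ₒ_ : ∣ U ∣ → ∣ O ∣ → ∣ P ∣ → Set
  u —[ o ]→ₒ p = σ o ≡ u × t o ≡ p

  ●_ : ∣ P ∣ → Pred ∣ U ∣ 0ℓ
  ● p = λ u → ∃[ o ] (u —[ o ]→ₒ p)

  _● : ∣ P ∣ → Pred ∣ U ∣ 0ℓ
  p ● = λ u → ∃[ i ] (p —[ i ]→ᵢ u)

  Step : ∣ P ∣ → ∣ P ∣ → Set
  Step p q = ∃[ i ] ∃[ u ] ∃[ o ] (p —[ i ]→ᵢ u × u —[ o ]→ₒ q)

  _→∃_ : ∣ P ∣ → ∣ P ∣ → Set
  _→∃_ = TransClosure Step

Connected : Computon → Set
Connected Λ = ∀ p → p ∈ Im s ∪ P⁺ → ∃[ q ] (q ∈ P⁻ × p →∃ q)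
  where open Computon Λ

Trivial : Computon → Set
Trivial Λ = ¬ ∣ U ∣ × ¬ ∣ I ∣ × ¬ ∣ O ∣
  where open Computon Λ

-- Natural transformations whose colour component is an inclusion.

record Nat (Λ₁ Λ₂ : Computon) : Set where
  private
    module A = Computon Λ₁
    module B = Computon Λ₂
  field
    onU : ∣ A.U ∣ → ∣ B.U ∣
    onP : ∣ A.P ∣ → ∣ B.P ∣
    onI : ∣ A.I ∣ → ∣ B.I ∣
    onO : ∣ A.O ∣ → ∣ B.O ∣
    colours-⊆ : A.colours ⊆ₗ B.colours
    nat-σ : ∀ o → onU (A.σ o) ≡ B.σ (onO o)
    nat-τ : ∀ i → onU (A.τ i) ≡ B.τ (onI i)
    nat-t : ∀ o → onP (A.t o) ≡ B.t (onO o)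
    nat-s : ∀ i → onP (A.s i) ≡ B.s (onI i)
    nat-c : ∀ p → A.c p ≡ B.c (onP p)

  i⃗ o⃗ : Pred ∣ A.P ∣ 0ℓ
  i⃗ p = Satisfiable ((B.● onP p) ∖ Image onU (A.● p))
  o⃗ p = Satisfiable ((onP p B.●) ∖ Image onU (p A.●))

_∘ₙ_ : ∀ {Λ₁ Λ₂ Λ₃} → Nat Λ₂ Λ₃ → Nat Λ₁ Λ₂ → Nat Λ₁ Λ₃
β ∘ₙ α = record
  { onU = β.onU ∘ α.onU
  ; onP = β.onP ∘ α.onP
  ; onI = β.onI ∘ α.onI
  ; onO = β.onO ∘ α.onO
  ; colours-⊆ = β.colours-⊆ ∘ α.colours-⊆
  ; nat-σ = λ o → trans (cong β.onU (α.nat-σ o)) (β.nat-σ (α.onO o))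
  ; nat-τ = λ i → trans (cong β.onU (α.nat-τ i)) (β.nat-τ (α.onI i))
  ; nat-t = λ o → trans (cong β.onP (α.nat-t o)) (β.nat-t (α.onO o))
  ; nat-s = λ i → trans (cong β.onP (α.nat-s i)) (β.nat-s (α.onI i))
  ; nat-c = λ p → trans (α.nat-c p) (β.nat-c (α.onP p))
  }
  where
  module α = Nat α
  module β = Nat β

record _≈ₙ_ {Λ₁ Λ₂ : Computon} (α β : Nat Λ₁ Λ₂) : Set where
  private
    module α = Nat α
    module β = Nat β
  field
    ≈U : ∀ u → α.onU u ≡ β.onU u
    ≈P : ∀ p → α.onP p ≡ β.onP p
    ≈I : ∀ i → α.onI i ≡ β.onI i
    ≈O : ∀ o → α.onO o ≡ β.onO o

infix 4 _⇒_ _≈ₙ_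
infixr 9 _∘ₙ_

record _⇒_ (Λ₁ Λ₂ : Computon) : Set where
  field
    nat : Nat Λ₁ Λ₂
  open Nat nat public
  open Computon Λ₁ using (P⁺; P⁻)
  field
    boundary : i⃗ ∪ o⃗ ⊆ P⁺ ∪ P⁻

open _⇒_ public using (nat)

-- Left cancellability among computon morphisms; equality of morphisms is
-- equality of the underlying natural transformations.

Mono : ∀ {Λ₁ Λ₂} → Λ₁ ⇒ Λ₂ → Set₁
Mono {Λ₁} α = ∀ {Ξ} (g h : Ξ ⇒ Λ₁) →
  nat α ∘ₙ nat g ≈ₙ nat α ∘ₙ nat h → nat g ≈ₙ nat h

record InMarker (Λ₀ Λ : Computon) : Set₁ where
  field
    mor     : Λ₀ ⇒ Λ
    trivial : Trivial Λ₀
    mono    : Mono mor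
    image   : Im (_⇒_.onP mor) ≐ Computon.P⁺ Λ

record OutMarker (Λ₀ Λ : Computon) : Set₁ where
  field
    mor     : Λ₀ ⇒ Λ
    trivial : Trivial Λ₀
    mono    : Mono mor
    image   : Im (_⇒_.onP mor) ≐ Computon.P⁻ Λ

data Node : Set where
  n₀ n₁ n₂ n₃ n₄ body : Node

data Edge : Node → Node → Set where
  out₂    : Edge n₀ n₂
  in₄     : Edge n₀ n₄
  inBody  : Edge n₀ body
  out₃    : Edge n₀ n₃
  outBody : Edge n₁ body
  in₃     : Edge n₁ n₃

-- h-diagrams in which Λ is the computon being iterated over.

record HDiagram (Λ : Computon) : Set₁ where
  field
    Λ₀ Λ₁ Λ₂ Λ₃ Λ₄ : Computon

    trivial₀ : Trivial Λ₀
    trivial₁ : Trivial Λ₁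

    connected  : Connected Λ
    connected₂ : Connected Λ₂
    connected₃ : Connected Λ₃
    connected₄ : Connected Λ₄

    Λ₂⁻ : OutMarker Λ₀ Λ₂
    Λ₄⁺ : InMarker  Λ₀ Λ₄
    Λ⁺  : InMarker  Λ₀ Λ
    Λ₃⁻ : OutMarker Λ₀ Λ₃
    Λ⁻  : OutMarker Λ₁ Λ
    Λ₃⁺ : InMarker  Λ₁ Λ₃

  node : Node → Computon
  node n₀   = Λ₀
  node n₁   = Λ₁
  node n₂   = Λ₂
  node n₃   = Λ₃
  node n₄   = Λ₄
  node body = Λ

  edge : ∀ {a b} → Edge a b → node a ⇒ node b
  edge out₂    = OutMarker.mor Λ₂⁻
  edge in₄     = InMarker.mor  Λ₄⁺
  edge inBody  = InMarker.mor  Λ⁺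
  edge out₃    = OutMarker.mor Λ₃⁻
  edge outBody = OutMarker.mor Λ⁻
  edge in₃     = InMarker.mor  Λ₃⁺

-- Colimits of diagrams of finite sets of the shape of an h-diagram.

IsCocone : (D : Node → FinSet) (d : ∀ {a b} → Edge a b → ∣ D a ∣ → ∣ D b ∣)
           (X : FinSet) → (∀ a → ∣ D a ∣ → ∣ X ∣) → Set
IsCocone D d X f = ∀ {a b} (e : Edge a b) x → f b (d e x) ≡ f a x

record IsColimit (D : Node → FinSet)
                 (d : ∀ {a b} → Edge a b → ∣ D a ∣ → ∣ D b ∣)
                 (K : FinSet) (κ : ∀ a → ∣ D a ∣ → ∣ K ∣) : Set₁ where
  field
    commutes  : IsCocone D d K κ
    universal : ∀ (X : FinSet) (f : ∀ a → ∣ D a ∣ → ∣ X ∣) → IsCocone D d X f →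
      Σ[ h ∈ (∣ K ∣ → ∣ X ∣) ]
        ((∀ a x → h (κ a x) ≡ f a x) ×
         (∀ (h′ : ∣ K ∣ → ∣ X ∣) → (∀ a x → h′ (κ a x) ≡ f a x) → ∀ y → h′ y ≡ h y))

  jointly-epic : (X : FinSet) (g h : ∣ K ∣ → ∣ X ∣) →
    (∀ a x → g (κ a x) ≡ h (κ a x)) → ∀ y → g y ≡ h y
  jointly-epic X g h eq y = trans (unique g eq y) (sym (unique h (λ _ _ → refl) y))
    where
    unique = proj₂ (proj₂ (universal X (λ a → h ∘ κ a) (λ e x → cong h (commutes e x))))

-- Colimits of computons are componentwise: a cocone of computon morphisms
-- whose components on U, P, I and O are colimits of finite sets and whose
-- colours are the union of those of the diagram.  Naturality of the legs
-- makes the structure functions of the apex the induced ones, and the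
-- colimit exists when these form a computon and the legs are morphisms.
--
-- Such a cocone has the universal property proved in `factor` below.  The
-- mediating transformation cannot also be required to satisfy `boundary`:
-- ports of Λ₀ are external in every node but internal in the apex, so a
-- competing cocone may attach arbitrarily many further units to them.  A
-- mediating computon morphism would have to hit all of these units, which
-- no finite apex allows.

record HeadIterative {Λ : Computon} (ρ : HDiagram Λ) : Set₁ where
  open HDiagram ρ
  field
    apex : Computon
    leg  : ∀ a → node a ⇒ apex
  open Computon
  open _⇒_
  field
    colimU : IsColimit (U ∘ node) (onU ∘ edge) (U apex) (onU ∘ leg)
    colimP : IsColimit (P ∘ node) (onP ∘ edge) (P apex) (onP ∘ leg)
    colimI : IsColimit (I ∘ node) (onI ∘ edge) (I apex) (onI ∘ leg)
    colimO : IsColimit (O ∘ node) (onO ∘ edge) (O apex) (onO ∘ leg)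
    colours-∪ : ∀ k → k ∈ₗ colours apex ⇔ (∃[ a ] k ∈ₗ colours (node a))

  private
    module κU = IsColimit colimU
    module κP = IsColimit colimP
    module κI = IsColimit colimI
    module κO = IsColimit colimO
    module L a = _⇒_ (leg a)

  factor : (Ξ : Computon) (f : ∀ a → node a ⇒ Ξ) →
    (∀ {a b} (e : Edge a b) → nat (f b) ∘ₙ nat (edge e) ≈ₙ nat (f a)) →
    Σ[ h ∈ Nat apex Ξ ]
      ((∀ a → h ∘ₙ nat (leg a) ≈ₙ nat (f a)) ×
       (∀ (h′ : Nat apex Ξ) → (∀ a → h′ ∘ₙ nat (leg a) ≈ₙ nat (f a)) → h′ ≈ₙ h))
  factor Ξ f comm = h , h-commutes , h-unique
    where
    open _≈ₙ_
    module F a = _⇒_ (f a)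

    uU = κU.universal (U Ξ) F.onU (λ e → ≈U (comm e))
    uP = κP.universal (P Ξ) F.onP (λ e → ≈P (comm e))
    uI = κI.universal (I Ξ) F.onI (λ e → ≈I (comm e))
    uO = κO.universal (O Ξ) F.onO (λ e → ≈O (comm e))

    hU = proj₁ uU
    hP = proj₁ uP
    hI = proj₁ uI
    hO = proj₁ uO

    βU = proj₁ (proj₂ uU)
    βP = proj₁ (proj₂ uP)
    βI = proj₁ (proj₂ uI)
    βO = proj₁ (proj₂ uO)

    natural : ∀ {A : Node → FinSet} {B : Node → Set} {K : FinSet} {L X : Set} (Y : FinSet)
      {d : ∀ {a b} → Edge a b → ∣ A a ∣ → ∣ A b ∣}
      {κ : ∀ a → ∣ A a ∣ → ∣ K ∣} {ℓ : ∀ a → B a → L}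
      {φ : ∀ a → ∣ A a ∣ → X} {ψ : ∀ a → B a → ∣ Y ∣}
      {g : ∣ K ∣ → X} {k : L → ∣ Y ∣}
      (m : ∀ a → ∣ A a ∣ → B a) (m′ : ∣ K ∣ → L) (m″ : X → ∣ Y ∣) →
      IsColimit A d K κ →
      (∀ a x → g (κ a x) ≡ φ a x) → (∀ a x → k (ℓ a x) ≡ ψ a x) →
      (∀ a x → ℓ a (m a x) ≡ m′ (κ a x)) → (∀ a x → ψ a (m a x) ≡ m″ (φ a x)) →
      ∀ y → k (m′ y) ≡ m″ (g y)
    natural Y {κ = κ} {ℓ} {φ} {ψ} {g} {k} m m′ m″ col gκ kℓ nκ nφ =
      IsColimit.jointly-epic col Y (k ∘ m′) (m″ ∘ g) λ a x → begin
        k (m′ (κ a x))  ≡⟨ cong k (nκ a x) ⟨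
        k (ℓ a (m a x)) ≡⟨ kℓ a (m a x) ⟩
        ψ a (m a x)     ≡⟨ nφ a x ⟩
        m″ (φ a x)      ≡⟨ cong m″ (gκ a x) ⟨
        m″ (g (κ a x))  ∎
      where open ≡-Reasoning

    -- ℕ is not finite, so κP.jointly-epic is applied to decided equality.
    h-c : ∀ y → c apex y ≡ c Ξ (hP y)
    h-c y = does-true (c apex y ≟ c Ξ (hP y))
      (κP.jointly-epic bool (λ y → does (c apex y ≟ c Ξ (hP y))) (λ _ → true)
        (λ a x → dec-true (c apex (L.onP a x) ≟ c Ξ (hP (L.onP a x)))
          (trans (sym (L.nat-c a x)) (trans (F.nat-c a x) (cong (c Ξ) (sym (βP a x))))))
        y)
      where
      bool : FinSet
      bool = record { Carrier = Bool ; size = 2 ; enum = ↔-sym 2↔Bool }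

      does-true : ∀ {A : Set} (A? : Dec A) → does A? ≡ true → A
      does-true (yes x) _ = x

    h : Nat apex Ξ
    h = record
      { onU = hU ; onP = hP ; onI = hI ; onO = hO
      ; colours-⊆ = λ {k} k∈ →
          let a , k∈a = Equivalence.to (colours-∪ k) k∈ in F.colours-⊆ a k∈a
      ; nat-σ = natural (U Ξ) {ℓ = L.onU} {k = hU} (σ ∘ node) (σ apex) (σ Ξ) colimO βO βU L.nat-σ F.nat-σ
      ; nat-τ = natural (U Ξ) {ℓ = L.onU} {k = hU} (τ ∘ node) (τ apex) (τ Ξ) colimI βI βU L.nat-τ F.nat-τ
      ; nat-t = natural (P Ξ) {ℓ = L.onP} {k = hP} (t ∘ node) (t apex) (t Ξ) colimO βO βP L.nat-t F.nat-t
      ; nat-s = natural (P Ξ) {ℓ = L.onP} {k = hP} (s ∘ node) (s apex) (s Ξ) colimI βI βP L.nat-s F.nat-s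
      ; nat-c = h-c
      }

    h-commutes : ∀ a → h ∘ₙ nat (leg a) ≈ₙ nat (f a)
    h-commutes a = record { ≈U = βU a ; ≈P = βP a ; ≈I = βI a ; ≈O = βO a }

    h-unique : ∀ h′ → (∀ a → h′ ∘ₙ nat (leg a) ≈ₙ nat (f a)) → h′ ≈ₙ h
    h-unique h′ eq = record
      { ≈U = proj₂ (proj₂ uU) (Nat.onU h′) (λ a → ≈U (eq a))
      ; ≈P = proj₂ (proj₂ uP) (Nat.onP h′) (λ a → ≈P (eq a))
      ; ≈I = proj₂ (proj₂ uI) (Nat.onI h′) (λ a → ≈I (eq a))
      ; ≈O = proj₂ (proj₂ uO) (Nat.onO h′) (λ a → ≈O (eq a))
      }

{-# OPTIONS --safe #-}
-- Only the existence of the colimit for connected λ needs work.  Take for λ₀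
-- and λ₁ the e-inports and the e-outports of λ, and for λ₂, λ₃ and λ₄
-- computons with a single unit, whose e-inports and e-outports are copies of
-- those of λ₀ or λ₁ as the markers demand.  Every port of a trivial or a
-- one-unit computon is external, so the boundary condition only has content
-- for the leg from λ, and the units which that leg attaches to λ are attached
-- to ports in the images of the two markers, that is, to external ports.

module Submission where

open import Defs
open import Data.Empty using (⊥; ⊥-elim)
open import Data.Fin using (Fin; zero; suc)
open import Data.Fin.Properties as Fin using (any?; 0↔⊥; 1↔⊤; +↔⊎)
open import Data.List using (List; lookup; filter; tabulate; length; _++_)
open import Data.List.Membership.Propositional using () renaming (_∈_ to _∈ₗ_)
open import Data.List.Membership.Propositional.Properties
  using (∈-filter⁺; ∈-filter⁻; ∈-lookup; ∈-tabulate⁺; ∈-tabulate⁻; ∈-++⁺ˡ; ∈-++⁺ʳ; ∈-++⁻)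
open import Data.List.Relation.Binary.Subset.Propositional using () renaming (_⊆_ to _⊆ₗ_)
open import Data.List.Relation.Unary.All as All using ()
open import Data.List.Relation.Unary.AllPairs using (_∷_)
open import Data.List.Relation.Unary.Any using (index)
open import Data.List.Relation.Unary.Any.Properties using (lookup-index)
open import Data.List.Relation.Unary.Unique.Propositional using (Unique)
import Data.List.Relation.Unary.Unique.Propositional.Properties as Unique
open import Data.Nat using (ℕ)
open import Data.Product using (Σ; ∃-syntax; _×_; _,_; proj₁; proj₂)
open import Data.Sum using (_⊎_; inj₁; inj₂; [_,_]; [_,_]′)
open import Data.Sum.Properties using (inj₁-injective; inj₂-injective)
open import Data.Sum.Function.Propositional using (_⊎-↔_)
open import Data.Unit using (⊤; tt)
open import Function using (_∘_; id; _↔_; _⇔_; mk⇔; mk↔ₛ′; Inverse)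
open import Function.Definitions using (Injective)
open import Function.Properties.Inverse using (↔-refl; ↔-sym; ↔-trans; ↔⇒↣)
open import Level using (0ℓ)
open import Relation.Binary.Construct.Closure.Transitive using () renaming ([_] to [_]⁺)
open import Relation.Binary.Definitions using (DecidableEquality)
open import Relation.Binary.PropositionalEquality using (_≡_; refl; sym; trans; cong; subst)
open import Relation.Nullary using (¬_; contradiction)
open import Relation.Nullary.Decidable using (¬?; via-injection; map′)
open import Relation.Unary using (Pred; Decidable; _≐_)

-- Finite sets

∅ : FinSet
∅ = record { Carrier = ⊥ ; size = 0 ; enum = ↔-sym 0↔⊥ }

𝟙 : FinSet
𝟙 = record { Carrier = ⊤ ; size = 1 ; enum = ↔-sym 1↔⊤ }

infixr 4 _⊕_

_⊕_ : FinSet → FinSet → FinSet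
A ⊕ B = record
  { Carrier = ∣ A ∣ ⊎ ∣ B ∣
  ; size    = _
  ; enum    = ↔-trans (FinSet.enum A ⊎-↔ FinSet.enum B) (↔-sym +↔⊎)
  }

-- The dependent sum makes every coprojection uniformly `a ,_`; the iterated binary sum `S` supplies
-- the enumeration.
∐ : (Node → FinSet) → FinSet
∐ D = record
  { Carrier = Σ Node λ a → ∣ D a ∣
  ; size    = FinSet.size S
  ; enum    = ↔-trans (mk↔ₛ′ to from to∘from from∘to) (FinSet.enum S)
  }
  where
  S : FinSet
  S = D n₀ ⊕ D n₁ ⊕ D n₂ ⊕ D n₃ ⊕ D n₄ ⊕ D body

  to : Σ Node (λ a → ∣ D a ∣) → ∣ S ∣
  to (n₀   , x) = inj₁ x
  to (n₁   , x) = inj₂ (inj₁ x)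
  to (n₂   , x) = inj₂ (inj₂ (inj₁ x))
  to (n₃   , x) = inj₂ (inj₂ (inj₂ (inj₁ x)))
  to (n₄   , x) = inj₂ (inj₂ (inj₂ (inj₂ (inj₁ x))))
  to (body , x) = inj₂ (inj₂ (inj₂ (inj₂ (inj₂ x))))

  from : ∣ S ∣ → Σ Node (λ a → ∣ D a ∣)
  from = [ n₀ ,_ , [ n₁ ,_ , [ n₂ ,_ , [ n₃ ,_ , [ n₄ ,_ , body ,_ ]′ ]′ ]′ ]′ ]′

  to∘from : ∀ y → to (from y) ≡ y
  to∘from (inj₁ _)                             = refl
  to∘from (inj₂ (inj₁ _))                      = refl
  to∘from (inj₂ (inj₂ (inj₁ _)))               = refl
  to∘from (inj₂ (inj₂ (inj₂ (inj₁ _))))        = refl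
  to∘from (inj₂ (inj₂ (inj₂ (inj₂ (inj₁ _))))) = refl
  to∘from (inj₂ (inj₂ (inj₂ (inj₂ (inj₂ _))))) = refl

  from∘to : ∀ x → from (to x) ≡ x
  from∘to (n₀   , _) = refl
  from∘to (n₁   , _) = refl
  from∘to (n₂   , _) = refl
  from∘to (n₃   , _) = refl
  from∘to (n₄   , _) = refl
  from∘to (body , _) = refl

-- All edges start in n₀ or n₁, so without elements there nothing is glued.
∐-isColimit : (D : Node → FinSet) (d : ∀ {a b} → Edge a b → ∣ D a ∣ → ∣ D b ∣) →
  ¬ ∣ D n₀ ∣ → ¬ ∣ D n₁ ∣ → IsColimit D d (∐ D) (λ a x → a , x)
∐-isColimit D d ¬D₀ ¬D₁ = record
  { commutes  = λ e x → ⊥-elim (source-empty e x)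
  ; universal = λ X f _ →
      (λ (a , x) → f a x) , (λ _ _ → refl) , λ h′ eq (a , x) → eq a x
  }
  where
  source-empty : ∀ {a b} → Edge a b → ¬ ∣ D a ∣
  source-empty out₂    = ¬D₀
  source-empty in₄     = ¬D₀
  source-empty inBody  = ¬D₀
  source-empty out₃    = ¬D₀
  source-empty outBody = ¬D₁
  source-empty in₃     = ¬D₁

-- Decidable images and subsets of finite sets

module _ (A : FinSet) where
  open FinSet A using (enum)
  open Inverse enum using (to; from)

  infix 4 _≟_

  _≟_ : DecidableEquality ∣ A ∣
  _≟_ = via-injection (↔⇒↣ enum) Fin._≟_

  Im? : ∀ {B : Set} → DecidableEquality B → (f : ∣ A ∣ → B) → Decidable (Im f)
  Im? _≟ᴮ_ f y = map′ (λ (k , eq) → from k , eq)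
    (λ (x , eq) → to x , trans (cong f (Inverse.strictlyInverseʳ enum x)) eq)
    (any? λ k → f (from k) ≟ᴮ y)

-- The head of a repetition-free list differs from every later entry. This is what makes the
-- embeddings of the boundary ports injective.
lookup-injective : ∀ {A : Set} {xs : List A} → Unique xs → Injective _≡_ _≡_ (lookup xs)
lookup-injective (x≢ ∷ _) {zero}  {zero}  _  = refl
lookup-injective (x≢ ∷ _) {zero}  {suc j} eq = contradiction eq (All.lookup x≢ (∈-lookup j))
lookup-injective (x≢ ∷ _) {suc i} {zero}  eq = contradiction (sym eq) (All.lookup x≢ (∈-lookup i))
lookup-injective (_ ∷ u)  {suc i} {suc j} eq = cong suc (lookup-injective u eq)

-- An injection with image `Q` replaces the type of elements paired with proofs of `Q`: without
-- function extensionality, proofs of a negation cannot be shown equal, so those pairs could not be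
-- counted.
record Subset {A : Set} (Q : Pred A 0ℓ) : Set₁ where
  field
    set       : FinSet
    embed     : ∣ set ∣ → A
    injective : Injective _≡_ _≡_ embed
    image     : Im embed ≐ Q

subset : (A : FinSet) {Q : Pred ∣ A ∣ 0ℓ} → Decidable Q → Subset Q
subset A {Q} Q? = record
  { set       = record { Carrier = Fin (length xs) ; size = length xs ; enum = ↔-refl }
  ; embed     = lookup xs
  ; injective = lookup-injective (Unique.filter⁺ Q? (Unique.tabulate⁺ from-injective))
  ; image     = (λ { (i , refl) → proj₂ (∈-filter⁻ Q? {xs = tabulate from} (∈-lookup i)) })
              , λ q → let x∈ = ∈-filter⁺ Q? (∈-tabulate-from _) q in
                      index x∈ , sym (lookup-index x∈)
  }
  where
  open FinSet A using (enum)
  open Inverse enum using (to; from; strictlyInverseˡ; strictlyInverseʳ)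

  xs : List ∣ A ∣
  xs = filter Q? (tabulate from)

  from-injective : ∀ {i j} → from i ≡ from j → i ≡ j
  from-injective {i} {j} eq =
    trans (sym (strictlyInverseˡ i)) (trans (cong to eq) (strictlyInverseˡ j))

  ∈-tabulate-from : ∀ x → x ∈ₗ tabulate from
  ∈-tabulate-from x = subst (_∈ₗ tabulate from) (strictlyInverseʳ x) (∈-tabulate⁺ (to x))

-- Trivial computons and their morphisms

module _ (A : FinSet) (c : ∣ A ∣ → ℕ) (x₀ : ∃[ x ] c x ≡ 0) where
  open FinSet A using (enum)
  open Inverse enum using (to; from; strictlyInverseʳ)

  private
    c-into : ∀ x → c x ∈ₗ tabulate (c ∘ from)
    c-into x = subst (_∈ₗ tabulate (c ∘ from)) (cong c (strictlyInverseʳ x)) (∈-tabulate⁺ (to x))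

  discrete : Computon
  discrete = record
    { U = ∅ ; P = A ; I = ∅ ; O = ∅
    ; colours = tabulate (c ∘ from)
    ; σ = id ; τ = id ; t = λ () ; s = λ () ; c = c
    ; P-nonempty = proj₁ x₀
    ; c-into     = c-into
    ; 0-colour   = subst (_∈ₗ tabulate (c ∘ from)) (proj₂ x₀) (c-into (proj₁ x₀))
    ; σ-surj  = λ ()
    ; τ-surj  = λ ()
    ; c-surj  = λ k∈ → let i , eq = ∈-tabulate⁻ k∈ in from i , sym eq
    ; σ-surj₀ = λ ()
    ; τ-surj₀ = λ ()
    ; outport₀ = proj₁ x₀ , (λ ()) , proj₂ x₀
    ; inport₀  = proj₁ x₀ , (λ ()) , proj₂ x₀
    }

  discrete-trivial : Trivial discrete
  discrete-trivial = id , id , id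

-- By surjectivity of `c`, every colour of `Λ₁` is the colour of some port, and the image of that
-- port has the same colour.
c-preserving⇒colours-⊆ : ∀ Λ₁ Λ₂ (f : ∣ Computon.P Λ₁ ∣ → ∣ Computon.P Λ₂ ∣) →
  (∀ p → Computon.c Λ₁ p ≡ Computon.c Λ₂ (f p)) → Computon.colours Λ₁ ⊆ₗ Computon.colours Λ₂
c-preserving⇒colours-⊆ Λ₁ Λ₂ f nat-c k∈ with Computon.c-surj Λ₁ k∈
... | p , refl = subst (_∈ₗ Computon.colours Λ₂) (sym (nat-c p)) (Computon.c-into Λ₂ (f p))

module _ {Λ₀ Λ : Computon} (triv : Trivial Λ₀) where
  private
    module Λ₀ = Computon Λ₀
    module Λ  = Computon Λ
    ¬U = proj₁ triv
    ¬I = proj₁ (proj₂ triv)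
    ¬O = proj₂ (proj₂ triv)

  fromTrivial : (f : ∣ Λ₀.P ∣ → ∣ Λ.P ∣) → (∀ p → Λ₀.c p ≡ Λ.c (f p)) → Λ₀ ⇒ Λ
  fromTrivial f nat-c = record
    { nat = record
      { onU = ⊥-elim ∘ ¬U ; onP = f ; onI = ⊥-elim ∘ ¬I ; onO = ⊥-elim ∘ ¬O
      ; colours-⊆ = c-preserving⇒colours-⊆ Λ₀ Λ f nat-c
      ; nat-σ = ⊥-elim ∘ ¬O
      ; nat-τ = ⊥-elim ∘ ¬I
      ; nat-t = ⊥-elim ∘ ¬O
      ; nat-s = ⊥-elim ∘ ¬I
      ; nat-c = nat-c
      }
    -- Without out-edges no port lies in the image of `t`, so every port of `Λ₀` is an e-inport.
    ; boundary = λ _ → inj₁ (¬O ∘ proj₁)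
    }

  -- Whatever maps into a trivial computon has no units or edges either, so only the port components
  -- remain to be compared.
  fromTrivial-mono : (α : Λ₀ ⇒ Λ) → Injective _≡_ _≡_ (_⇒_.onP α) → Mono α
  fromTrivial-mono α inj g h αg≈αh = record
    { ≈U = ⊥-elim ∘ ¬U ∘ _⇒_.onU g
    ; ≈P = inj ∘ _≈ₙ_.≈P αg≈αh
    ; ≈I = ⊥-elim ∘ ¬I ∘ _⇒_.onI g
    ; ≈O = ⊥-elim ∘ ¬O ∘ _⇒_.onO g
    }

  module _ (f : ∣ Λ₀.P ∣ → ∣ Λ.P ∣) (inj : Injective _≡_ _≡_ f)
           (nat-c : ∀ p → Λ₀.c p ≡ Λ.c (f p)) where

    inMarker : Im f ≐ Λ.P⁺ → InMarker Λ₀ Λ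
    inMarker image = record
      { mor = fromTrivial f nat-c ; trivial = triv
      ; mono = fromTrivial-mono (fromTrivial f nat-c) inj ; image = image }

    outMarker : Im f ≐ Λ.P⁻ → OutMarker Λ₀ Λ
    outMarker image = record
      { mor = fromTrivial f nat-c ; trivial = triv
      ; mono = fromTrivial-mono (fromTrivial f nat-c) inj ; image = image }

-- Computons with a single unit

module OneUnit (A B : Computon) where
  private
    module A = Computon A
    module B = Computon B
    a₀ = proj₁ A.outport₀
    b₀ = proj₁ B.outport₀
    c-a₀ = proj₂ (proj₂ A.outport₀)
    c-b₀ = proj₂ (proj₂ B.outport₀)

  -- Each port of `A` feeds the unit through its own edge, and the unit feeds each port of `B`
  -- likewise. Hence the ports of `A` are the e-inports and those of `B` the e-outports.
  computon : Computon
  computon = record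
    { U = 𝟙 ; P = A.P ⊕ B.P ; I = A.P ; O = B.P
    ; colours = A.colours ++ B.colours
    ; σ = λ _ → tt ; τ = λ _ → tt
    ; t = inj₂ ; s = inj₁
    ; c = [ A.c , B.c ]′
    ; P-nonempty = inj₁ A.P-nonempty
    ; c-into     = λ { (inj₁ a) → ∈-++⁺ˡ (A.c-into a) ; (inj₂ b) → ∈-++⁺ʳ A.colours (B.c-into b) }
    ; 0-colour   = ∈-++⁺ˡ A.0-colour
    ; σ-surj  = λ _ → b₀ , refl
    ; τ-surj  = λ _ → a₀ , refl
    ; c-surj  = λ k∈ → [ (λ k∈A → let a , eq = A.c-surj k∈A in inj₁ a , eq)
                       , (λ k∈B → let b , eq = B.c-surj k∈B in inj₂ b , eq)
                       ]′ (∈-++⁻ A.colours k∈)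
    ; σ-surj₀ = λ _ → b₀ , c-b₀ , refl
    ; τ-surj₀ = λ _ → a₀ , c-a₀ , refl
    ; outport₀ = inj₂ b₀ , (λ ()) , c-b₀
    ; inport₀  = inj₁ a₀ , (λ ()) , c-a₀
    }

  open Computon computon using (P⁺; P⁻)

  external : ∀ p → P⁺ p ⊎ P⁻ p
  external (inj₁ _) = inj₁ λ ()
  external (inj₂ _) = inj₂ λ ()

  -- The unit leads from any port of `A` to `b₀` in one step, while a port of `B` is neither in the
  -- image of `s` nor an e-inport.
  connected : Connected computon
  connected (inj₁ a) _                   = inj₂ b₀ , (λ ()) , [ a , tt , b₀ , (refl , refl) , refl , refl ]⁺
  connected (inj₂ b) (inj₁ (_ , ()))
  connected (inj₂ b) (inj₂ ∉Im-t)        = ⊥-elim (∉Im-t (b , refl))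

  in-marker : Trivial A → InMarker A computon
  in-marker triv = inMarker triv inj₁ inj₁-injective (λ _ → refl)
    ((λ { (_ , refl) () }) ,
     λ { {inj₁ a} _ → a , refl ; {inj₂ b} ∉Im-t → ⊥-elim (∉Im-t (b , refl)) })

  out-marker : Trivial B → OutMarker B computon
  out-marker triv = outMarker triv inj₂ inj₂-injective (λ _ → refl)
    ((λ { (_ , refl) () }) ,
     λ { {inj₁ a} ∉Im-s → ⊥-elim (∉Im-s (a , refl)) ; {inj₂ b} _ → b , refl })

-- Iterating over a connected computon

module Iteration (Λ : Computon) (conn : Connected Λ) where
  private
    open module Λ = Computon Λ using (P⁺; P⁻)

    entries : Subset P⁺
    entries = subset Λ.P (λ p → ¬? (Im? Λ.O (_≟_ Λ.P) Λ.t p))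

    exits : Subset P⁻
    exits = subset Λ.P (λ p → ¬? (Im? Λ.I (_≟_ Λ.P) Λ.s p))

    module Entry = Subset entries
    module Exit  = Subset exits

  -- Supplies the port of colour 0 that `discrete` asks for, taken from the boundary of λ.
  restrict : {Q : Pred ∣ Λ.P ∣ 0ℓ} (S : Subset Q) → ∃[ p ] (Q p × Λ.c p ≡ 0) →
    ∃[ x ] Λ.c (Subset.embed S x) ≡ 0
  restrict S (p , q , cp≡0) =
    let x , eq = proj₂ (Subset.image S) q in x , trans (cong Λ.c eq) cp≡0

  entry₀ : ∃[ x ] Λ.c (Entry.embed x) ≡ 0
  entry₀ = restrict entries Λ.inport₀

  exit₀ : ∃[ x ] Λ.c (Exit.embed x) ≡ 0
  exit₀ = restrict exits Λ.outport₀

  Λ₀ Λ₁ : Computon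
  Λ₀ = discrete Entry.set (Λ.c ∘ Entry.embed) entry₀
  Λ₁ = discrete Exit.set  (Λ.c ∘ Exit.embed)  exit₀

  trivial₀ : Trivial Λ₀
  trivial₀ = discrete-trivial Entry.set (Λ.c ∘ Entry.embed) entry₀

  trivial₁ : Trivial Λ₁
  trivial₁ = discrete-trivial Exit.set (Λ.c ∘ Exit.embed) exit₀

  -- Any trivial computon could serve as the e-inports of λ₂ and as the
  -- e-outports of λ₄; with λ₀ no further colours arise.
  module Head = OneUnit Λ₀ Λ₀
  module Back = OneUnit Λ₁ Λ₀

  ρ : HDiagram Λ
  ρ = record
    { Λ₀ = Λ₀ ; Λ₁ = Λ₁
    ; Λ₂ = Head.computon ; Λ₃ = Back.computon ; Λ₄ = Head.computon
    ; trivial₀ = trivial₀ ; trivial₁ = trivial₁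
    ; connected = conn
    ; connected₂ = Head.connected ; connected₃ = Back.connected ; connected₄ = Head.connected
    ; Λ₂⁻ = Head.out-marker trivial₀
    ; Λ₄⁺ = Head.in-marker trivial₀
    ; Λ⁺  = inMarker trivial₀ Entry.embed Entry.injective (λ _ → refl) Entry.image
    ; Λ₃⁻ = Back.out-marker trivial₀
    ; Λ⁻  = outMarker trivial₁ Exit.embed Exit.injective (λ _ → refl) Exit.image
    ; Λ₃⁺ = Back.in-marker trivial₁
    }

  -- The apex

  open HDiagram ρ using (node; edge)
  open Computon using (U; P; I; O; σ; τ; t; s; c; σ-surj₀; τ-surj₀)

  -- An explicit form of the glued port set. Every class contains at most one port of λ, which
  -- represents it; the ports not glued to λ are the e-inports of λ₂ (`initial`) and the e-outports
  -- of λ₄ (`final`).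
  apexP : FinSet
  apexP = P Λ₀ ⊕ Λ.P ⊕ P Λ₀

  pattern initial x = inj₁ x
  pattern inner p   = inj₂ (inj₁ p)
  pattern final x   = inj₂ (inj₂ x)

  κP : ∀ a → ∣ P (node a) ∣ → ∣ apexP ∣
  κP n₀ x          = inner (Entry.embed x)
  κP n₁ x          = inner (Exit.embed x)
  κP n₂ (inj₁ x)   = initial x
  κP n₂ (inj₂ x)   = inner (Entry.embed x)
  κP n₃ (inj₁ x)   = inner (Exit.embed x)
  κP n₃ (inj₂ x)   = inner (Entry.embed x)
  κP n₄ (inj₁ x)   = inner (Entry.embed x)
  κP n₄ (inj₂ x)   = final x
  κP body p        = inner p

  apexC : ∣ apexP ∣ → ℕ
  apexC = [ c Λ₀ , [ Λ.c , c Λ₀ ]′ ]′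

  κP-c : ∀ a p → c (node a) p ≡ apexC (κP a p)
  κP-c n₀ _        = refl
  κP-c n₁ _        = refl
  κP-c n₂ (inj₁ _) = refl
  κP-c n₂ (inj₂ _) = refl
  κP-c n₃ (inj₁ _) = refl
  κP-c n₃ (inj₂ _) = refl
  κP-c n₄ (inj₁ _) = refl
  κP-c n₄ (inj₂ _) = refl
  κP-c body _      = refl

  apexC-into : ∀ y → apexC y ∈ₗ Λ.colours
  apexC-into (initial x) = Λ.c-into (Entry.embed x)
  apexC-into (inner p)   = Λ.c-into p
  apexC-into (final x)   = Λ.c-into (Entry.embed x)

  apex : Computon
  apex = record
    { U = ∐ (U ∘ node) ; P = apexP ; I = ∐ (I ∘ node) ; O = ∐ (O ∘ node)
    ; colours = Λ.colours
    ; σ = λ (a , o) → a , σ (node a) o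
    ; τ = λ (a , i) → a , τ (node a) i
    ; t = λ (a , o) → κP a (t (node a) o)
    ; s = λ (a , i) → κP a (s (node a) i)
    ; c = apexC
    ; P-nonempty = inner Λ.P-nonempty
    ; c-into     = apexC-into
    ; 0-colour   = Λ.0-colour
    ; σ-surj  = λ u → let o , _ , eq = σ-surj₀′ u in o , eq
    ; τ-surj  = λ u → let i , _ , eq = τ-surj₀′ u in i , eq
    ; c-surj  = λ k∈ → let p , eq = Λ.c-surj k∈ in inner p , eq
    ; σ-surj₀ = σ-surj₀′
    ; τ-surj₀ = τ-surj₀′
    -- In-edges never start at a `final` port and out-edges never end at an `initial` one; λ₀ and λ₁
    -- have no edges to consider.
    ; outport₀ = let x , eq = entry₀ in
        final x , (λ { ((n₂ , _) , ()) ; ((n₃ , _) , ()) ; ((n₄ , _) , ()) ; ((body , _) , ()) }) , eq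
    ; inport₀  = let x , eq = entry₀ in
        initial x , (λ { ((n₂ , _) , ()) ; ((n₃ , _) , ()) ; ((n₄ , _) , ()) ; ((body , _) , ()) }) , eq
    }
    where
    σ-surj₀′ : (u : ∣ ∐ (U ∘ node) ∣) →
      ∃[ o ] (apexC (κP (proj₁ o) (t (node (proj₁ o)) (proj₂ o))) ≡ 0 × (proj₁ o , σ (node (proj₁ o)) (proj₂ o)) ≡ u)
    σ-surj₀′ (a , u) with σ-surj₀ (node a) u
    ... | o , c≡0 , refl = (a , o) , trans (sym (κP-c a _)) c≡0 , refl

    τ-surj₀′ : (u : ∣ ∐ (U ∘ node) ∣) →
      ∃[ i ] (apexC (κP (proj₁ i) (s (node (proj₁ i)) (proj₂ i))) ≡ 0 × (proj₁ i , τ (node (proj₁ i)) (proj₂ i)) ≡ u)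
    τ-surj₀′ (a , u) with τ-surj₀ (node a) u
    ... | i , c≡0 , refl = (a , i) , trans (sym (κP-c a _)) c≡0 , refl

  -- The legs and the boundary condition

  legₙ : ∀ a → Nat (node a) apex
  legₙ a = record
    { onU = a ,_ ; onP = κP a ; onI = a ,_ ; onO = a ,_
    ; colours-⊆ = c-preserving⇒colours-⊆ (node a) apex (κP a) (κP-c a)
    ; nat-σ = λ _ → refl
    ; nat-τ = λ _ → refl
    ; nat-t = λ _ → refl
    ; nat-s = λ _ → refl
    ; nat-c = κP-c a
    }

  inner-injective : ∀ {p q} → _≡_ {A = ∣ apexP ∣} (inner p) (inner q) → p ≡ q
  inner-injective = inj₁-injective ∘ inj₂-injective

  entry∈P⁺ : ∀ {x p} → _≡_ {A = ∣ apexP ∣} (inner (Entry.embed x)) (inner p) → P⁺ p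
  entry∈P⁺ eq = proj₁ Entry.image (_ , inner-injective eq)

  exit∈P⁻ : ∀ {x p} → _≡_ {A = ∣ apexP ∣} (inner (Exit.embed x)) (inner p) → P⁻ p
  exit∈P⁻ eq = proj₁ Exit.image (_ , inner-injective eq)

  -- From outside λ, only the out-edges of λ₂ and λ₃ reach inner ports, and they end at glued
  -- e-inports. An out-edge of λ itself contributes no new unit.
  body-i⃗ : ∀ p → Nat.i⃗ (legₙ body) p → P⁺ p
  body-i⃗ p (_ , ((n₂ , _) , _ , eq) , _) = entry∈P⁺ eq
  body-i⃗ p (_ , ((n₃ , _) , _ , eq) , _) = entry∈P⁺ eq
  body-i⃗ p (_ , ((n₄ , _) , _ , ()) , _)
  body-i⃗ p (_ , ((body , o) , refl , eq) , ∉●p) =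
    contradiction (Λ.σ o , (o , refl , inner-injective eq) , refl) ∉●p

  -- In-edges of λ₃ start at glued e-outports of λ, those of λ₄ at glued e-inports, and those of λ₂
  -- at `initial` ports, never at inner ones.
  body-o⃗ : ∀ p → Nat.o⃗ (legₙ body) p → P⁺ p ⊎ P⁻ p
  body-o⃗ p (_ , ((n₂ , _) , () , _) , _)
  body-o⃗ p (_ , ((n₃ , _) , eq , _) , _) = inj₂ (exit∈P⁻ eq)
  body-o⃗ p (_ , ((n₄ , _) , eq , _) , _) = inj₁ (entry∈P⁺ eq)
  body-o⃗ p (_ , ((body , i) , eq , refl) , ∉p●) =
    contradiction (Λ.τ i , (i , inner-injective eq , refl) , refl) ∉p●

  leg : ∀ a → node a ⇒ apex
  leg a = record { nat = legₙ a ; boundary = boundary a _ }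
    where
    boundary : ∀ a p → Nat.i⃗ (legₙ a) p ⊎ Nat.o⃗ (legₙ a) p →
      Computon.P⁺ (node a) p ⊎ Computon.P⁻ (node a) p
    boundary n₀   _ _        = inj₁ λ ()
    boundary n₁   _ _        = inj₁ λ ()
    boundary n₂   p _        = Head.external p
    boundary n₃   p _        = Back.external p
    boundary n₄   p _        = Head.external p
    boundary body p (inj₁ i) = inj₁ (body-i⃗ p i)
    boundary body p (inj₂ o) = body-o⃗ p o

  -- The colimit property

  colimP : IsColimit (P ∘ node) (_⇒_.onP ∘ edge) apexP κP
  colimP = record
    { commutes  = λ
        { out₂ _ → refl ; in₄ _ → refl ; inBody _ → refl
        ; out₃ _ → refl ; outBody _ → refl ; in₃ _ → refl }
    ; universal = λ X f comm →
        mediate X f , mediate-κP X f comm , λ h′ eq →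
          -- The legs from λ₂, λ and λ₄ jointly cover the three summands, which forces every value
          -- of `h′`.
          [ eq n₂ ∘ inj₁ , [ eq body , eq n₄ ∘ inj₂ ] ]
    }
    where
    mediate : ∀ X (f : ∀ a → ∣ P (node a) ∣ → ∣ X ∣) → ∣ apexP ∣ → ∣ X ∣
    mediate X f = [ f n₂ ∘ inj₁ , [ f body , f n₄ ∘ inj₂ ]′ ]′

    mediate-κP : ∀ X f → IsCocone (P ∘ node) (_⇒_.onP ∘ edge) X f →
      ∀ a x → mediate X f (κP a x) ≡ f a x
    mediate-κP X f comm n₀ x        = comm inBody x
    mediate-κP X f comm n₁ x        = comm outBody x
    mediate-κP X f comm n₂ (inj₁ x) = refl
    -- Both sides equal `f n₀ x`, since this port is glued to λ along the two markers from λ₀; the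
    -- ports of λ₃ and λ₄ are treated alike, via λ₀ or λ₁.
    mediate-κP X f comm n₂ (inj₂ x) = trans (comm inBody x) (sym (comm out₂ x))
    mediate-κP X f comm n₃ (inj₁ x) = trans (comm outBody x) (sym (comm in₃ x))
    mediate-κP X f comm n₃ (inj₂ x) = trans (comm inBody x) (sym (comm out₃ x))
    mediate-κP X f comm n₄ (inj₁ x) = trans (comm inBody x) (sym (comm in₄ x))
    mediate-κP X f comm n₄ (inj₂ x) = refl
    mediate-κP X f comm body x      = refl

  headIterative : HeadIterative ρ
  headIterative = record
    { apex   = apex
    ; leg    = leg
    -- `id` proves that the empty sets of units and edges of λ₀ and λ₁ have no elements.
    ; colimU = ∐-isColimit (U ∘ node) (_⇒_.onU ∘ edge) id id
    ; colimP = colimP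
    ; colimI = ∐-isColimit (I ∘ node) (_⇒_.onI ∘ edge) id id
    ; colimO = ∐-isColimit (O ∘ node) (_⇒_.onO ∘ edge) id id
    ; colours-∪ = λ k → mk⇔ (body ,_) (λ (a , k∈) → Nat.colours-⊆ (legₙ a) k∈)
    }

theorem4 : (Λ : Computon) → Connected Λ ⇔ Σ (HDiagram Λ) HeadIterative
theorem4 Λ = mk⇔
  (λ conn → Iteration.ρ Λ conn , Iteration.headIterative Λ conn)
  -- Conversely, an h-diagram includes the connectedness of its iterated computon.
  (HDiagram.connected ∘ proj₁)
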